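{- Let $d\ge1$, $n\ge1$, and let $Q$ be a $d$-dimensional latin hypercube of order $n$. Then $Q$ contains exactly $n^{3d-1}$ cuboctahedra if and only if for every pair of directions $1\le i<j\le d$ there is a latin square $L^{i,j}$ of order $n$, isotopic to the Cayley table of some group, such that every $2$-dimensional plane of $Q$ of direction $(i,j)$ is principally isotopic to $L^{i,j}$.
   Context: A $d$-dimensional latin hypercube of order $n$ is an array $Q=(q_\alpha)$ indexed by $\alpha\in\{0,\ldots,n-1\}^d$ with entries in $\{0,\ldots,n-1\}$ such that any two indices differing in exactly one coordinate carry different symbols. A cuboctahedron in $Q$ is a tuple consisting of $d$ ordered pairs $(a^i_1,a^i_2)$ and $d$ ordered pairs $(b^i_1,b^i_2)$, $i=1,\ldots,d$, of elements of $\{0,\ldots,n-1\}$, such that $q_{a^1_{j_1},\ldots,a^d_{j_d}}=q_{b^1_{j_1},\ldots,b^d_{j_d}}$ for all $j_1,\ldots,j_d\in\{1,2\}$; cuboctahedra are counted as such tuples. A $2$-dimensional plane of direction $(i,j)$ is the $n\times n$ latin square obtained by letting coordinates $i$ and $j$ vary (rows indexed by coordinate $i$, columns by coordinate $j$) with all other coordinates fixed. Two latin squares are isotopic if one is obtained from the other by permuting rows, columns and symbols; principally isotopic if by permuting rows and columns only. A latin square is isotopic to the Cayley table of a group if it is isotopic to the multiplication table of a group of order $n$ with elements labelled $0,\ldots,n-1$. -}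

module Defs where

open import Data.Nat using (ℕ; zero; suc; _+_)
open import Data.Bool using (Bool; true; false; if_then_else_)
open import Data.Fin using (Fin; _≟_)
open import Data.Fin.Permutation using (Permutation′; _⟨$⟩ʳ_)
open import Data.Vec using (Vec; []; _∷_; _[_]≔_)
open import Data.List using (List; map; allFin)
open import Data.Nat.ListAction using (sum)
open import Data.Product using (Σ; _×_; _,_; ∃)
open import Relation.Binary.PropositionalEquality using (_≡_; _≢_)
open import Relation.Nullary using (Dec; yes; no; ¬_)
open import Relation.Nullary.Decidable using (⌊_⌋)
open import Algebra.Structures using (IsGroup)

Index : ℕ → ℕ → Set
Index n d = Vec (Fin n) d

Hypercube : ℕ → ℕ → Set
Hypercube n d = Index n d → Fin n

DifferInExactlyOne : ∀ {n d} → Index n d → Index n d → Set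
DifferInExactlyOne {n} {d} α β =
  Σ (Fin d) λ i → (Data.Vec.lookup α i ≢ Data.Vec.lookup β i)
    × (∀ k → k ≢ i → Data.Vec.lookup α k ≡ Data.Vec.lookup β k)

IsLatinHypercube : ∀ {n d} → Hypercube n d → Set
IsLatinHypercube {n} {d} Q = ∀ α β → DifferInExactlyOne α β → Q α ≢ Q β

Square : ℕ → Set
Square n = Fin n → Fin n → Fin n

IsLatinSquare : ∀ {n} → Square n → Set
IsLatinSquare L = (∀ x y y′ → y ≢ y′ → L x y ≢ L x y′)
                × (∀ x x′ y → x ≢ x′ → L x y ≢ L x′ y)

Isotopic : ∀ {n} → Square n → Square n → Set
Isotopic {n} L₁ L₂ = Σ (Permutation′ n) λ σ → Σ (Permutation′ n) λ τ →
  Σ (Permutation′ n) λ φ → ∀ x y → L₁ x y ≡ φ ⟨$⟩ʳ (L₂ (σ ⟨$⟩ʳ x) (τ ⟨$⟩ʳ y))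

PrincipallyIsotopic : ∀ {n} → Square n → Square n → Set
PrincipallyIsotopic {n} L₁ L₂ = Σ (Permutation′ n) λ σ → Σ (Permutation′ n) λ τ →
  ∀ x y → L₁ x y ≡ L₂ (σ ⟨$⟩ʳ x) (τ ⟨$⟩ʳ y)

IsotopicToGroupTable : ∀ {n} → Square n → Set
IsotopicToGroupTable {n} L =
  Σ (Fin n → Fin n → Fin n) λ _∙_ → Σ (Fin n) λ e → Σ (Fin n → Fin n) λ inv →
    IsGroup _≡_ _∙_ e inv × Isotopic L _∙_

plane : ∀ {n d} → Hypercube n d → Fin d → Fin d → Index n d → Square n
plane Q i j α x y = Q ((α [ i ]≔ x) [ j ]≔ y)

-- select s a b: coordinate k is taken from a if s k = true (j_k = 1), from b otherwise (j_k = 2).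
select : ∀ {A : Set} {d} → Vec Bool d → Vec A d → Vec A d → Vec A d
select [] [] [] = []
select (s ∷ ss) (x ∷ a) (y ∷ b) = (if s then x else y) ∷ select ss a b

-- The tuple ((a₁ k , a₂ k))_k , ((b₁ k , b₂ k))_k is a cuboctahedron in Q.
IsCuboctahedron : ∀ {n d} → Hypercube n d →
  Index n d → Index n d → Index n d → Index n d → Set
IsCuboctahedron {n} {d} Q a₁ a₂ b₁ b₂ =
  ∀ (s : Vec Bool d) → Q (select s a₁ a₂) ≡ Q (select s b₁ b₂)

allBool? : ∀ {d} {P : Vec Bool d → Set} → (∀ s → Dec (P s)) → Dec (∀ s → P s)
allBool? {zero} {P} p with p []
... | yes q = yes λ { [] → q }
... | no ¬q = no λ f → ¬q (f [])
allBool? {suc d} {P} p with allBool? {d} {λ s → P (true ∷ s)} (λ s → p (true ∷ s))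
                          | allBool? {d} {λ s → P (false ∷ s)} (λ s → p (false ∷ s))
... | yes t | yes f = yes λ { (true ∷ s) → t s ; (false ∷ s) → f s }
... | no ¬t | _ = no λ g → ¬t (λ s → g (true ∷ s))
... | yes _ | no ¬f = no λ g → ¬f (λ s → g (false ∷ s))

isCuboctahedron? : ∀ {n d} (Q : Hypercube n d) a₁ a₂ b₁ b₂ →
  Dec (IsCuboctahedron Q a₁ a₂ b₁ b₂)
isCuboctahedron? Q a₁ a₂ b₁ b₂ =
  allBool? (λ s → Q (select s a₁ a₂) ≟ Q (select s b₁ b₂))

sumIndex : ∀ {n} d → (Index n d → ℕ) → ℕ
sumIndex {n} zero f = f []
sumIndex {n} (suc d) f = sum (map (λ x → sumIndex d (λ v → f (x ∷ v))) (allFin n))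

numCuboctahedra : ∀ {n d} → Hypercube n d → ℕ
numCuboctahedra {n} {d} Q =
  sumIndex d λ a₁ → sumIndex d λ a₂ → sumIndex d λ b₁ → sumIndex d λ b₂ →
    if ⌊ isCuboctahedron? Q a₁ a₂ b₁ b₂ ⌋ then 1 else 0

{-# OPTIONS --safe #-}
-- Fix a₁, a₂, b₁ with Q a₁ ≡ Q b₁.  The corners differing from a₁ in one
-- coordinate determine b₂ uniquely, so there are at most n ^ (3d - 1)
-- cuboctahedra, with equality iff every such b₂ closes up.  Closing up is
-- equivalent to the quadrangle criterion holding between any two parallel
-- planes: the plane condition is the case of two free coordinates, and conversely
-- it propagates equality to all corners.  Finally, the quadrangle criterion
-- within a plane means that it is a group table up to isotopy, and between two
-- planes that they are principally isotopic.
module Submission where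

open import Defs
open import Algebra.Bundles using (Group)
open import Algebra.Structures using (IsGroup)
import Algebra.Properties.Group as GroupProperties
open import Data.Bool using (Bool; true; false; if_then_else_)
open import Data.Fin using (Fin; zero; suc; _<_; _≟_; punchOut)
open import Data.Fin.Permutation using (Permutation′; permutation; _⟨$⟩ʳ_; _⟨$⟩ˡ_; inverseˡ; inverseʳ; flip; _∘ₚ_)
import Data.Fin.Permutation as Perm
open import Data.Fin.Properties using (any?; injective⇒≤; punchOut-injective; <⇒≢; suc-injective)
open import Data.List using (map; allFin)
open import Data.List.Properties using (map-cong; map-tabulate)
open import Data.Nat using (ℕ; zero; suc; _≤_; z≤n; s≤s; _+_; _*_; _∸_; _^_)
open import Data.Nat.ListAction using (sum)
open import Data.Nat.Properties using (≤-reflexive; ≤-antisym; +-mono-≤; +-monoˡ-≤; +-monoʳ-≤; +-cancelˡ-≤; +-cancelʳ-≤; +-identityʳ; *-zeroʳ; *-assoc; ^-distribˡ-+-*; 1+n≰n)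
open import Data.Nat.Solver using (module +-*-Solver)
open import Data.Product using (Σ; _×_; _,_; proj₁; proj₂; ∃)
open import Data.Vec using (Vec; []; _∷_; lookup; replicate; _[_]≔_)
import Data.Vec as Vec
open import Data.Vec.Properties using (lookup∘update; lookup∘update′; lookup∘tabulate; lookup-replicate; tabulate∘lookup; tabulate-cong; []≔-commutes; []≔-idempotent; []≔-lookup)
open import Function using (_∘_; id)
open import Function.Bundles using (_⇔_; mk⇔; Equivalence)
open import Function.Definitions using (Injective)
open import Relation.Binary.PropositionalEquality using (_≡_; _≢_; refl; sym; trans; cong; cong₂; subst; isEquivalence; module ≡-Reasoning)
open import Relation.Nullary using (Dec; yes; no; ¬_; contradiction)
open import Relation.Nullary.Decidable using (⌊_⌋; decidable-stable)

private
  variable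
    n d : ℕ

injective⇒preimage : (f : Fin n → Fin n) → Injective _≡_ _≡_ f → ∀ y → ∃ λ x → f x ≡ y
injective⇒preimage {suc n} f inj y with any? (λ x → f x ≟ y)
... | yes found = found
-- If `y` is missed, deleting it from the codomain leaves an injection of `Fin (suc n)` into
-- `Fin n`.
... | no none = contradiction (injective⇒≤ punched-injective) 1+n≰n
  where
  y≢f : ∀ x → y ≢ f x
  y≢f x y≡fx = none (x , sym y≡fx)

  punched-injective : Injective _≡_ _≡_ (λ x → punchOut (y≢f x))
  punched-injective {x} {x′} eq = inj (punchOut-injective (y≢f x) (y≢f x′) eq)

injective⇒permutation : (f : Fin n → Fin n) → Injective _≡_ _≡_ f → Permutation′ n
injective⇒permutation f inj = permutation f (λ y → proj₁ (preimage y))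
  (λ y → proj₂ (preimage y)) (λ x → inj (proj₂ (preimage (f x))))
  where preimage = injective⇒preimage f inj

permutation-injective : (π : Permutation′ n) → Injective _≡_ _≡_ (π ⟨$⟩ʳ_)
permutation-injective π eq =
  trans (sym (inverseˡ π)) (trans (cong (π ⟨$⟩ˡ_) eq) (inverseˡ π))

≢-preserving⇒injective : (f : Fin n → Fin n) → (∀ x y → x ≢ y → f x ≢ f y) → Injective _≡_ _≡_ f
≢-preserving⇒injective f pres {x} {y} eq = decidable-stable (x ≟ y) λ x≢y → pres x y x≢y eq

-- Indicators and finite sums of natural numbers.

indicator : {P : Set} → Dec P → ℕ
indicator P? = if ⌊ P? ⌋ then 1 else 0

indicator-true : {P : Set} (P? : Dec P) → P → indicator P? ≡ 1
indicator-true (yes _) p = refl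
indicator-true (no ¬p) p = contradiction p ¬p

indicator-false : {P : Set} (P? : Dec P) → ¬ P → indicator P? ≡ 0
indicator-false (yes p) ¬p = contradiction p ¬p
indicator-false (no _) ¬p = refl

indicator-mono : {P R : Set} (P? : Dec P) (R? : Dec R) → (P → R) → indicator P? ≤ indicator R?
indicator-mono (yes p) R? f = ≤-reflexive (sym (indicator-true R? (f p)))
indicator-mono (no _) R? f = z≤n

indicator-reflects : {P : Set} (P? : Dec P) → indicator P? ≡ 1 → P
indicator-reflects (yes p) _ = p

sumFin : (Fin n → ℕ) → ℕ
sumFin f = sum (map f (allFin _))

sumFin-suc : (f : Fin (suc n) → ℕ) → sumFin f ≡ f zero + sumFin (f ∘ suc)
sumFin-suc f = cong (λ l → f zero + sum l)
  (trans (map-tabulate suc f) (sym (map-tabulate id (f ∘ suc))))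

sumFin-cong : {f g : Fin n → ℕ} → (∀ x → f x ≡ g x) → sumFin f ≡ sumFin g
sumFin-cong eq = cong sum (map-cong eq (allFin _))

sumFin-const : ∀ n c → sumFin {n} (λ _ → c) ≡ n * c
sumFin-const zero c = refl
sumFin-const (suc n) c = trans (sumFin-suc {n} (λ _ → c)) (cong (c +_) (sumFin-const n c))

sumFin-zero : {f : Fin n → ℕ} → (∀ x → f x ≡ 0) → sumFin f ≡ 0
sumFin-zero {n} eq = trans (sumFin-cong eq) (trans (sumFin-const n 0) (*-zeroʳ n))

sumFin-single : (f : Fin n → ℕ) (x : Fin n) → (∀ y → y ≢ x → f y ≡ 0) → sumFin f ≡ f x
sumFin-single f zero off = trans (sumFin-suc f)
  (trans (cong (f zero +_) (sumFin-zero (λ y → off (suc y) (λ ())))) (+-identityʳ _))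
sumFin-single f (suc x) off = trans (sumFin-suc f)
  (cong₂ _+_ (off zero (λ ()))
    (sumFin-single (f ∘ suc) x (λ y y≢x → off (suc y) (y≢x ∘ suc-injective))))

sumFin-mono : {f g : Fin n → ℕ} → (∀ x → f x ≤ g x) → sumFin f ≤ sumFin g
sumFin-mono {zero} le = z≤n
sumFin-mono {suc n} {f} {g} le rewrite sumFin-suc f | sumFin-suc g =
  +-mono-≤ (le zero) (sumFin-mono (le ∘ suc))

+-tight : ∀ {a b c e} → a ≤ b → c ≤ e → a + c ≡ b + e → a ≡ b × c ≡ e
+-tight {a} {b} {c} {e} a≤b c≤e eq =
  ≤-antisym a≤b (+-cancelʳ-≤ e b a (subst (_≤ a + e) eq (+-monoʳ-≤ a c≤e))) ,
  ≤-antisym c≤e (+-cancelˡ-≤ b e c (subst (_≤ b + c) eq (+-monoˡ-≤ c a≤b)))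

-- No term can make up for a deficit in another. This turns an equality of total counts into an
-- equality for every single index.
sumFin-tight : {f g : Fin n → ℕ} → (∀ x → f x ≤ g x) → sumFin f ≡ sumFin g → ∀ x → f x ≡ g x
sumFin-tight {suc n} {f} {g} le eq = λ where
    zero → proj₁ split
    (suc x) → sumFin-tight (le ∘ suc) (proj₂ split) x
  where
  split = +-tight (le zero) (sumFin-mono (le ∘ suc))
    (trans (sym (sumFin-suc f)) (trans eq (sumFin-suc g)))

sumIndex-cong : ∀ d {f g : Index n d → ℕ} → (∀ v → f v ≡ g v) → sumIndex d f ≡ sumIndex d g
sumIndex-cong zero eq = eq []
sumIndex-cong (suc d) eq = sumFin-cong λ x → sumIndex-cong d λ v → eq (x ∷ v)

sumIndex-const : ∀ n d c → sumIndex {n} d (λ _ → c) ≡ n ^ d * c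
sumIndex-const n zero c = sym (+-identityʳ c)
sumIndex-const n (suc d) c =
  trans (sumFin-cong {n} (λ _ → sumIndex-const n d c))
    (trans (sumFin-const n _) (sym (*-assoc n (n ^ d) c)))

sumIndex-zero : ∀ d {f : Index n d → ℕ} → (∀ v → f v ≡ 0) → sumIndex d f ≡ 0
sumIndex-zero {n} d eq = trans (sumIndex-cong d eq) (trans (sumIndex-const n d 0) (*-zeroʳ (n ^ d)))

sumIndex-single : ∀ d (f : Index n d → ℕ) (v : Index n d) →
  (∀ w → w ≢ v → f w ≡ 0) → sumIndex d f ≡ f v
sumIndex-single zero f [] off = refl
sumIndex-single (suc d) f (x ∷ v) off = trans
  (sumFin-single _ x λ y y≢x → sumIndex-zero d λ w → off (y ∷ w) λ { refl → y≢x refl })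
  (sumIndex-single d (λ w → f (x ∷ w)) v λ w w≢v → off (x ∷ w) λ { refl → w≢v refl })

sumIndex-mono : ∀ d {f g : Index n d → ℕ} → (∀ v → f v ≤ g v) → sumIndex d f ≤ sumIndex d g
sumIndex-mono zero le = le []
sumIndex-mono (suc d) le = sumFin-mono λ x → sumIndex-mono d λ v → le (x ∷ v)

sumIndex-tight : ∀ d {f g : Index n d → ℕ} → (∀ v → f v ≤ g v) →
  sumIndex d f ≡ sumIndex d g → ∀ v → f v ≡ g v
sumIndex-tight zero le eq [] = eq
sumIndex-tight (suc d) le eq (x ∷ v) = sumIndex-tight d (λ w → le (x ∷ w))
  (sumFin-tight (λ y → sumIndex-mono d λ w → le (y ∷ w)) eq x) v

-- Corners of a box of indices.

select-update : {A : Set} (s : Vec Bool d) (i : Fin d) (t : Bool) (a b : Vec A d) →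
  select (s [ i ]≔ t) a b ≡ select s a b [ i ]≔ (if t then lookup a i else lookup b i)
select-update (_ ∷ _) zero t (_ ∷ _) (_ ∷ _) = refl
select-update (_ ∷ s) (suc i) t (_ ∷ a) (_ ∷ b) = cong (_ ∷_) (select-update s i t a b)

select-true : {A : Set} (a b : Vec A d) → select (replicate d true) a b ≡ a
select-true [] [] = refl
select-true (x ∷ a) (_ ∷ b) = cong (x ∷_) (select-true a b)

update-outer : {A : Set} (α : Vec A d) {i j : Fin d} → i ≢ j → ∀ {x y u} →
  ((α [ i ]≔ x) [ j ]≔ y) [ i ]≔ u ≡ (α [ i ]≔ u) [ j ]≔ y
update-outer α {i} {j} i≢j =
  trans ([]≔-commutes (α [ i ]≔ _) j i (i≢j ∘ sym)) (cong (_[ j ]≔ _) ([]≔-idempotent α i))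

-- Each two-dimensional face yields its fourth corner from the other three, so the corners with at
-- most one `false` generate all of them. The recursion restricts to a face with fixed first
-- coordinate and needs the same starting corners there.
corner-induction : ∀ d (E : Vec Bool d → Set) →
  (∀ i j → i < j → ∀ s → E ((s [ i ]≔ true) [ j ]≔ true) → E ((s [ i ]≔ false) [ j ]≔ true) →
    E ((s [ i ]≔ true) [ j ]≔ false) → E ((s [ i ]≔ false) [ j ]≔ false)) →
  E (replicate d true) → (∀ i → E (replicate d true [ i ]≔ false)) → ∀ s → E s
corner-induction zero E close base single [] = base
corner-induction (suc d) E close base single (true ∷ s) =
  corner-induction d (λ s → E (true ∷ s))
    (λ i j i<j s → close (suc i) (suc j) (s≤s i<j) (true ∷ s))
    base (λ i → single (suc i)) s
corner-induction (suc d) E close base single (false ∷ s) =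
  corner-induction d (λ s → E (false ∷ s))
    (λ i j i<j s → close (suc i) (suc j) (s≤s i<j) (false ∷ s))
    (single zero)
    -- The corner switched at the first coordinate and at `j` completes a face whose other three
    -- corners have at most one `false`.
    (λ j → close zero (suc j) (s≤s z≤n) (replicate (suc d) true)
      (subst (λ s → E (true ∷ s)) (sym (update-true d j)) base)
      (subst (λ s → E (false ∷ s)) (sym (update-true d j)) (single zero))
      (single (suc j)))
    s
  where
  update-true : ∀ d (j : Fin d) → replicate d true [ j ]≔ true ≡ replicate d true
  update-true d j = trans (cong (replicate d true [ j ]≔_) (sym (lookup-replicate j true)))
    ([]≔-lookup (replicate d true) j)

-- The quadrangle criterion for latin squares.

-- For `L` equal to `M` this is the classical quadrangle criterion. Allowing two squares makes it
-- possible to compare parallel planes.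
Quadrangle : Square n → Square n → Set
Quadrangle L M = ∀ {x y u v x′ y′ u′ v′} →
  L x y ≡ M x′ y′ → L u y ≡ M u′ y′ → L x v ≡ M x′ v′ → L u v ≡ M u′ v′

module _ {L : Square n} (latin : IsLatinSquare L) where

  row-permutation : Fin n → Permutation′ n
  row-permutation x = injective⇒permutation (L x) (≢-preserving⇒injective (L x) (proj₁ latin x))

  column-permutation : Fin n → Permutation′ n
  column-permutation y = injective⇒permutation (λ x → L x y)
    (≢-preserving⇒injective (λ x → L x y) λ x x′ → proj₂ latin x x′ y)

-- A principal loop isotope of L: its identity is the entry at (o , o).
module _ {L : Square n} (latin : IsLatinSquare L) (quad : Quadrangle L L) (o : Fin n) where

  private
    ρ = column-permutation latin o
    τ = row-permutation latin o

    _∙_ : Fin n → Fin n → Fin n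
    x ∙ y = L (ρ ⟨$⟩ˡ x) (τ ⟨$⟩ˡ y)

    e : Fin n
    e = L o o

    identityˡ : ∀ y → e ∙ y ≡ y
    identityˡ y = trans (cong (λ z → L z (τ ⟨$⟩ˡ y)) (inverseˡ ρ)) (inverseʳ τ)

    identityʳ : ∀ x → x ∙ e ≡ x
    identityʳ x = trans (cong (L (ρ ⟨$⟩ˡ x)) (inverseˡ τ)) (inverseʳ ρ)

    assoc : ∀ x y z → (x ∙ y) ∙ z ≡ x ∙ (y ∙ z)
    -- Compare rows `y`, `x ∙ y` and columns `e`, `z` with rows `e`, `x` and columns `y`, `y ∙ z`.
    -- The first three corners agree by the identity laws and the fourth is associativity.
    assoc x y z = quad {x = ρ ⟨$⟩ˡ y} {y = τ ⟨$⟩ˡ e} {x′ = ρ ⟨$⟩ˡ e} {y′ = τ ⟨$⟩ˡ y}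
      (trans (identityʳ y) (sym (identityˡ y)))
      (identityʳ (x ∙ y))
      (sym (identityˡ (y ∙ z)))

    -- The column of `x` contains `e` in exactly one row, which `ρ` turns into an element; this
    -- solves the equation for a left inverse. That it is a right inverse too comes from the
    -- quadrangle criterion.
    inv : Fin n → Fin n
    inv x = ρ ⟨$⟩ʳ (column-permutation latin (τ ⟨$⟩ˡ x) ⟨$⟩ˡ e)

    inv-inverseˡ : ∀ x → inv x ∙ x ≡ e
    inv-inverseˡ x = trans (cong (λ z → L z (τ ⟨$⟩ˡ x)) (inverseˡ ρ))
      (inverseʳ (column-permutation latin (τ ⟨$⟩ˡ x)))

    inv-inverseʳ : ∀ x → x ∙ inv x ≡ e
    inv-inverseʳ x = trans
      -- Rows `e`, `x` and columns `e`, `inv x` are compared with rows `inv x`, `e` and columns `x`,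
      -- `e`.
      (quad {x = ρ ⟨$⟩ˡ e} {y = τ ⟨$⟩ˡ e} {x′ = ρ ⟨$⟩ˡ inv x} {y′ = τ ⟨$⟩ˡ x}
            {u′ = ρ ⟨$⟩ˡ e} {v′ = τ ⟨$⟩ˡ e}
        (trans (identityʳ e) (sym (inv-inverseˡ x)))
        (trans (identityʳ x) (sym (identityˡ x)))
        (trans (identityˡ (inv x)) (sym (identityʳ (inv x)))))
      (identityʳ e)

  quadrangle⇒group : IsotopicToGroupTable L
  quadrangle⇒group = _∙_ , e , inv , isGroup ,
    ρ , τ , Perm.id , λ x y → sym (cong₂ L (inverseˡ ρ) (inverseˡ τ))
    where
    isGroup : IsGroup _≡_ _∙_ e inv
    isGroup = record
      { isMonoid = record
        { isSemigroup = record
          { isMagma = record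
            { isEquivalence = isEquivalence
            ; ∙-cong = cong₂ _∙_ }
          ; assoc = assoc }
        ; identity = identityˡ , identityʳ }
      ; inverse = inv-inverseˡ , inv-inverseʳ
      ; ⁻¹-cong = cong inv }

-- Row `o` of `M` is matched with row `o` of `L`, which fixes the image of every column. Column `o`
-- of `L` and its image then fix the image of every row. The criterion, based at `(o , o)`, extends
-- the agreement to all entries.
quadrangle⇒principallyIsotopic : {L M : Square n} → IsLatinSquare L → IsLatinSquare M →
  Fin n → Quadrangle L M → PrincipallyIsotopic L M
quadrangle⇒principallyIsotopic {L = L} {M} latinL latinM o quad =
  column-permutation latinL o ∘ₚ flip κ , row-permutation latinL o ∘ₚ flip μ ,
  λ x y → quad {x = o} {y = o} (sym (inverseʳ μ)) (sym (inverseʳ κ)) (sym (inverseʳ μ))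
  where
  μ = row-permutation latinM o
  -- This column of `M` is the image of column `o`: there row `o` contains `L o o`.
  κ = column-permutation latinM (μ ⟨$⟩ˡ L o o)

-- In a group the fourth entry is a function of the other three, since `u ∙ v` equals
-- `(u ∙ y) ∙ inv (x ∙ y) ∙ (x ∙ v)`.
group-quadrangle : {_∙_ : Square n} {e : Fin n} {inv : Fin n → Fin n} →
  IsGroup _≡_ _∙_ e inv → Quadrangle _∙_ _∙_
group-quadrangle {_∙_ = _∙_} {e} {inv} isGroup {x} {y} {u} {v} {x′} {y′} {u′} {v′} p q r =
  trans (express u v y x) (trans
    (cong₂ _∙_ (cong₂ _∙_ q (cong inv p)) r)
    (sym (express u′ v′ y′ x′)))
  where
  G : Group _ _
  G = record { isGroup = isGroup }
  open Group G using (assoc)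
  open GroupProperties G using (⁻¹-anti-homo-∙; \\-leftDividesʳ; //-rightDividesʳ)
  open ≡-Reasoning

  express : ∀ u v y x → u ∙ v ≡ ((u ∙ y) ∙ inv (x ∙ y)) ∙ (x ∙ v)
  express u v y x = sym (begin
    ((u ∙ y) ∙ inv (x ∙ y)) ∙ (x ∙ v)         ≡⟨ cong (λ z → ((u ∙ y) ∙ z) ∙ (x ∙ v)) (⁻¹-anti-homo-∙ x y) ⟩
    ((u ∙ y) ∙ (inv y ∙ inv x)) ∙ (x ∙ v)     ≡⟨ cong (_∙ (x ∙ v)) (assoc (u ∙ y) (inv y) (inv x)) ⟨
    (((u ∙ y) ∙ inv y) ∙ inv x) ∙ (x ∙ v)     ≡⟨ cong (λ z → (z ∙ inv x) ∙ (x ∙ v)) (//-rightDividesʳ y u) ⟩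
    (u ∙ inv x) ∙ (x ∙ v)                     ≡⟨ assoc u (inv x) (x ∙ v) ⟩
    u ∙ (inv x ∙ (x ∙ v))                     ≡⟨ cong (u ∙_) (\\-leftDividesʳ x v) ⟩
    u ∙ v                                     ∎)

-- The symbol permutation is injective, so equal entries of `L` come from equal entries of `M`.
isotope-quadrangle : {L M : Square n} → Isotopic L M → Quadrangle M M → Quadrangle L L
isotope-quadrangle {L = L} {M} (σ , τ , φ , eq) quad {x} {y} {u} {v} {x′} {y′} {u′} {v′} p q r =
  trans (eq u v) (trans (cong (φ ⟨$⟩ʳ_) (quad (descend p) (descend q) (descend r))) (sym (eq u′ v′)))
  where
  descend : ∀ {x y x′ y′} → L x y ≡ L x′ y′ →
    M (σ ⟨$⟩ʳ x) (τ ⟨$⟩ʳ y) ≡ M (σ ⟨$⟩ʳ x′) (τ ⟨$⟩ʳ y′)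
  descend p = permutation-injective φ (trans (sym (eq _ _)) (trans p (eq _ _)))

-- Principal isotopy leaves the symbols unchanged, so entries of `L` and of `M` can be compared with
-- each other inside `N`.
principallyIsotopic-quadrangle : {L M N : Square n} → PrincipallyIsotopic L N →
  PrincipallyIsotopic M N → Quadrangle N N → Quadrangle L M
principallyIsotopic-quadrangle {L = L} {M} (σ , τ , eqL) (σ′ , τ′ , eqM) quad p q r =
  trans (eqL _ _) (trans (quad (descend p) (descend q) (descend r)) (sym (eqM _ _)))
  where
  descend : ∀ {x y x′ y′} → L x y ≡ M x′ y′ → _ ≡ _
  descend p = trans (sym (eqL _ _)) (trans p (eqM _ _))

-- Planes, lines and symbol classes of a latin hypercube.

PlaneQuadrangle : Hypercube n d → Fin d → Fin d → Set
PlaneQuadrangle Q i j = ∀ α β → Quadrangle (plane Q i j α) (plane Q i j β)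

line-injective : (Q : Hypercube n d) → IsLatinHypercube Q → ∀ α i →
  Injective _≡_ _≡_ (λ x → Q (α [ i ]≔ x))
line-injective Q latin α i = ≢-preserving⇒injective _ λ x y x≢y →
  latin (α [ i ]≔ x) (α [ i ]≔ y)
    ( i
    , (λ eq → x≢y (trans (sym (lookup∘update i α x)) (trans eq (lookup∘update i α y))))
    , λ k k≢i → trans (lookup∘update′ k≢i α x) (sym (lookup∘update′ k≢i α y)))

-- Once all coordinates but the last are fixed, the symbol `c` occurs exactly once on the remaining
-- line.
fiber-size : ∀ d (Q : Hypercube n (suc d)) → IsLatinHypercube Q → ∀ c →
  sumIndex (suc d) (λ α → indicator (Q α ≟ c)) ≡ n ^ d
fiber-size zero Q latin c = trans
  (sumFin-single _ x λ y y≢x → indicator-false (Q (y ∷ []) ≟ c) λ eq →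
    y≢x (line-injective Q latin (c ∷ []) zero (trans eq (sym (inverseʳ line)))))
  (indicator-true (Q (x ∷ []) ≟ c) (inverseʳ line))
  where
  -- The vector `c ∷ []` is a placeholder, as its only entry is overwritten.
  line = injective⇒permutation _ (line-injective Q latin (c ∷ []) zero)
  x = line ⟨$⟩ˡ c
fiber-size {n} (suc d) Q latin c = trans
  (sumFin-cong {n} λ x → fiber-size d (λ v → Q (x ∷ v))
    (λ α β (i , ≢i , ≡rest) → latin (x ∷ α) (x ∷ β)
      (suc i , ≢i , λ { zero _ → refl ; (suc k) k≢i → ≡rest k (k≢i ∘ cong suc) })) c)
  (sumFin-const n (n ^ d))

module _ (Q : Hypercube n d) (latin : IsLatinHypercube Q) where

  plane-latin : ∀ {i j} → i ≢ j → ∀ α → IsLatinSquare (plane Q i j α)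
  plane-latin {i} {j} i≢j α =
    (λ x y y′ y≢y′ eq → y≢y′ (line-injective Q latin (α [ i ]≔ x) j eq)) ,
    (λ x x′ y x≢x′ eq → x≢x′ (line-injective Q latin (α [ j ]≔ y) i
      (trans (cong Q (sym ([]≔-commutes α i j i≢j))) (trans eq (cong Q ([]≔-commutes α i j i≢j))))))

  -- Completing three vectors to a cuboctahedron.

  private
    line : Index n d → Fin d → Permutation′ n
    line α i = injective⇒permutation _ (line-injective Q latin α i)

  -- The corner with only coordinate `i` switched forces entry `i` of the fourth vector. The symbol
  -- needed occurs on the line through `b₁`, so the candidate exists for every triple, even if
  -- `Q a₁` and `Q b₁` differ.
  completion : Index n d → Index n d → Index n d → Index n d
  completion a₁ a₂ b₁ = Vec.tabulate λ i → line b₁ i ⟨$⟩ˡ Q (a₁ [ i ]≔ lookup a₂ i)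

  completion-line : ∀ a₁ a₂ b₁ i →
    Q (b₁ [ i ]≔ lookup (completion a₁ a₂ b₁) i) ≡ Q (a₁ [ i ]≔ lookup a₂ i)
  completion-line a₁ a₂ b₁ i =
    trans (cong (line b₁ i ⟨$⟩ʳ_) (lookup∘tabulate _ i)) (inverseʳ (line b₁ i))

  completion-unique-at : ∀ a₁ a₂ b₁ i {x} → Q (a₁ [ i ]≔ lookup a₂ i) ≡ Q (b₁ [ i ]≔ x) →
    lookup (completion a₁ a₂ b₁) i ≡ x
  completion-unique-at a₁ a₂ b₁ i eq =
    line-injective Q latin b₁ i (trans (completion-line a₁ a₂ b₁ i) eq)

  select-single : ∀ i (a b : Index n d) →
    select (replicate d true [ i ]≔ false) a b ≡ a [ i ]≔ lookup b i
  select-single i a b =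
    trans (select-update (replicate d true) i false a b) (cong (_[ i ]≔ _) (select-true a b))

  completion-unique : ∀ a₁ a₂ b₁ b₂ → IsCuboctahedron Q a₁ a₂ b₁ b₂ → b₂ ≡ completion a₁ a₂ b₁
  completion-unique a₁ a₂ b₁ b₂ cub = trans (sym (tabulate∘lookup b₂)) (tabulate-cong λ i →
    trans (sym (completion-unique-at a₁ a₂ b₁ i (trans (sym (cong Q (select-single i a₁ a₂)))
      (trans (cub (replicate d true [ i ]≔ false)) (cong Q (select-single i b₁ b₂))))))
      (lookup∘tabulate _ i))

  Completes : Index n d → Index n d → Index n d → Set
  Completes a₁ a₂ b₁ = IsCuboctahedron Q a₁ a₂ b₁ (completion a₁ a₂ b₁)

  completes? : ∀ a₁ a₂ b₁ → Dec (Completes a₁ a₂ b₁)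
  completes? a₁ a₂ b₁ = isCuboctahedron? Q a₁ a₂ b₁ (completion a₁ a₂ b₁)

  completes-base : ∀ a₁ a₂ b₁ → Completes a₁ a₂ b₁ → Q b₁ ≡ Q a₁
  completes-base a₁ a₂ b₁ cub = trans (sym (cong Q (select-true b₁ _)))
    (trans (sym (cub (replicate d true))) (cong Q (select-true a₁ a₂)))

  -- The innermost sum has at most one nonzero term, the one at the only candidate for `b₂`.
  numCuboctahedra-completes : numCuboctahedra Q ≡
    (sumIndex d λ a₁ → sumIndex d λ a₂ → sumIndex d λ b₁ → indicator (completes? a₁ a₂ b₁))
  numCuboctahedra-completes = sumIndex-cong d λ a₁ → sumIndex-cong d λ a₂ → sumIndex-cong d λ b₁ →
    sumIndex-single d _ (completion a₁ a₂ b₁) λ b₂ b₂≢c →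
      indicator-false (isCuboctahedron? Q a₁ a₂ b₁ b₂) λ cub →
        b₂≢c (completion-unique a₁ a₂ b₁ b₂ cub)

  CompletesAll : Set
  CompletesAll = ∀ a₁ a₂ b₁ → Q b₁ ≡ Q a₁ → Completes a₁ a₂ b₁

  -- Take `a₁`, `a₂` as opposite corners in the first plane and `b₁` in the second. The two side
  -- equalities force the completion to have entries `u′` and `v′` at `i` and `j`, and the corner
  -- switched at exactly these two coordinates gives the claim.
  completesAll⇒planeQuadrangle : CompletesAll → ∀ {i j} → i ≢ j → PlaneQuadrangle Q i j
  completesAll⇒planeQuadrangle comp {i} {j} i≢j α β {x} {y} {u} {v} {x′} {y′} {u′} {v′} p q r =
    trans (cong Q (sym (corner α a₂ a₂-i a₂-j)))
      (trans (comp a₁ a₂ b₁ (sym p) _) (cong Q (corner β b₂ b₂-i b₂-j)))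
    where
    a₁ = (α [ i ]≔ x) [ j ]≔ y
    a₂ = (α [ i ]≔ u) [ j ]≔ v
    b₁ = (β [ i ]≔ x′) [ j ]≔ y′
    b₂ = completion a₁ a₂ b₁

    a₂-i : lookup a₂ i ≡ u
    a₂-i = trans (lookup∘update′ i≢j (α [ i ]≔ u) v) (lookup∘update i α u)

    a₂-j : lookup a₂ j ≡ v
    a₂-j = lookup∘update j (α [ i ]≔ u) v

    b₂-i : lookup b₂ i ≡ u′
    b₂-i = completion-unique-at a₁ a₂ b₁ i
      (trans (cong Q (trans (cong (a₁ [ i ]≔_) a₂-i) (update-outer α i≢j)))
        (trans q (cong Q (sym (update-outer β i≢j)))))

    b₂-j : lookup b₂ j ≡ v′
    b₂-j = completion-unique-at a₁ a₂ b₁ j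
      (trans (cong Q (trans (cong (a₁ [ j ]≔_) a₂-j) ([]≔-idempotent (α [ i ]≔ x) j)))
        (trans r (cong Q (sym ([]≔-idempotent (β [ i ]≔ x′) j)))))

    corner : ∀ α c {x y u v} → lookup c i ≡ u → lookup c j ≡ v →
      select ((replicate d true [ i ]≔ false) [ j ]≔ false) ((α [ i ]≔ x) [ j ]≔ y) c
        ≡ (α [ i ]≔ u) [ j ]≔ v
    corner α c {x} {y} refl refl = trans
      (select-update (replicate d true [ i ]≔ false) j false _ c)
      (trans (cong (_[ j ]≔ lookup c j) (trans (select-single i _ c) (update-outer α i≢j)))
        ([]≔-idempotent (α [ i ]≔ lookup c i) j))

  -- The unswitched corner agrees by hypothesis and the once-switched corners by the choice of the
  -- completion. The quadrangle criterion closes each two-dimensional face, so corner induction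
  -- reaches the rest.
  planeQuadrangle⇒completesAll : (∀ i j → i < j → PlaneQuadrangle Q i j) → CompletesAll
  planeQuadrangle⇒completesAll quad a₁ a₂ b₁ base = corner-induction d
    (λ s → Q (select s a₁ a₂) ≡ Q (select s b₁ b₂))
    (λ i j i<j s p q r → trans (cong Q (update₂ s i j false false a₁ a₂))
      (trans (quad i j i<j (select s a₁ a₂) (select s b₁ b₂)
        (descend s i j true true p) (descend s i j false true q) (descend s i j true false r))
      (cong Q (sym (update₂ s i j false false b₁ b₂)))))
    (trans (cong Q (select-true a₁ a₂)) (trans (sym base) (cong Q (sym (select-true b₁ b₂)))))
    (λ i → trans (cong Q (select-single i a₁ a₂))
      (trans (sym (completion-line a₁ a₂ b₁ i)) (cong Q (sym (select-single i b₁ b₂)))))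
    where
    b₂ = completion a₁ a₂ b₁

    update₂ : ∀ s i j t t′ (a b : Index n d) → select ((s [ i ]≔ t) [ j ]≔ t′) a b ≡
      (select s a b [ i ]≔ (if t then lookup a i else lookup b i))
        [ j ]≔ (if t′ then lookup a j else lookup b j)
    update₂ s i j t t′ a b = trans (select-update (s [ i ]≔ t) j t′ a b)
      (cong (_[ j ]≔ _) (select-update s i t a b))

    descend : ∀ s i j t t′ →
      Q (select ((s [ i ]≔ t) [ j ]≔ t′) a₁ a₂) ≡ Q (select ((s [ i ]≔ t) [ j ]≔ t′) b₁ b₂) →
      Q ((select s a₁ a₂ [ i ]≔ (if t then lookup a₁ i else lookup a₂ i))
          [ j ]≔ (if t′ then lookup a₁ j else lookup a₂ j)) ≡
      Q ((select s b₁ b₂ [ i ]≔ (if t then lookup b₁ i else lookup b₂ i))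
          [ j ]≔ (if t′ then lookup b₁ j else lookup b₂ j))
    descend s i j t t′ p = trans (cong Q (sym (update₂ s i j t t′ a₁ a₂)))
      (trans p (cong Q (update₂ s i j t t′ b₁ b₂)))

-- Group structure on the planes.

GroupPlanes : Hypercube n d → Set
GroupPlanes {n} {d} Q = ∀ (i j : Fin d) → i < j →
  Σ (Square n) λ L → IsLatinSquare L × IsotopicToGroupTable L
    × (∀ (α : Index n d) → PrincipallyIsotopic (plane Q i j α) L)

planeQuadrangle⇒groupPlanes : Fin n → (Q : Hypercube n d) → IsLatinHypercube Q →
  (∀ i j → i < j → PlaneQuadrangle Q i j) → GroupPlanes Q
planeQuadrangle⇒groupPlanes {d = d} o Q latin quad i j i<j =
  plane Q i j α₀ , planes α₀ , quadrangle⇒group (planes α₀) (quad i j i<j α₀ α₀) o ,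
  λ α → quadrangle⇒principallyIsotopic (planes α) (planes α₀) o (quad i j i<j α α₀)
  where
  -- Any index would do: it only selects the plane that serves as `L` for the given direction.
  α₀ = replicate d o
  planes = plane-latin Q latin (<⇒≢ i<j)

groupPlanes⇒planeQuadrangle : (Q : Hypercube n d) → GroupPlanes Q →
  ∀ i j → i < j → PlaneQuadrangle Q i j
groupPlanes⇒planeQuadrangle Q planes i j i<j α β {u′ = u′} {v′} =
  let L , _ , (_∙_ , _ , _ , isGroup , isotopic) , principal = planes i j i<j in
  principallyIsotopic-quadrangle {N = L} (principal α) (principal β)
    (isotope-quadrangle {L = L} {_∙_} isotopic (group-quadrangle isGroup)) {u′ = u′} {v′}

-- The maximal count and the main equivalence.

-- Cuboctahedra correspond to triples that complete, and these lie among the triples with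
-- `Q b₁ ≡ Q a₁`. The latter number `n ^ (3 * suc d ∸ 1)`, so the count reaches this value exactly
-- when all of them complete.
numCuboctahedra-max⇔completesAll : ∀ d (Q : Hypercube n (suc d)) (latin : IsLatinHypercube Q) →
  numCuboctahedra Q ≡ n ^ (3 * suc d ∸ 1) ⇔ CompletesAll Q latin
numCuboctahedra-max⇔completesAll {n} d Q latin = mk⇔
  (λ eq a₁ a₂ b₁ base → indicator-reflects (completes? Q latin a₁ a₂ b₁)
    (trans (pointwise eq a₁ a₂ b₁) (indicator-true (Q b₁ ≟ Q a₁) base)))
  (λ comp → trans (numCuboctahedra-completes Q latin) (trans
    (sumIndex-cong (suc d) λ a₁ → sumIndex-cong (suc d) λ a₂ → sumIndex-cong (suc d) λ b₁ →
      ≤-antisym (bound a₁ a₂ b₁)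
        (indicator-mono (Q b₁ ≟ Q a₁) (completes? Q latin a₁ a₂ b₁) (comp a₁ a₂ b₁)))
    total))
  where
  bound : ∀ a₁ a₂ b₁ → indicator (completes? Q latin a₁ a₂ b₁) ≤ indicator (Q b₁ ≟ Q a₁)
  bound a₁ a₂ b₁ =
    indicator-mono (completes? Q latin a₁ a₂ b₁) (Q b₁ ≟ Q a₁) (completes-base Q latin a₁ a₂ b₁)

  exponent : ∀ d → suc d + (suc d + d) ≡ 3 * suc d ∸ 1
  -- The right side is what `3 * suc d ∸ 1` computes to, with one `suc` already cancelled.
  exponent d = solve 1 (λ d → con 1 :+ d :+ (con 1 :+ d :+ d) :=
    d :+ (con 1 :+ d :+ (con 1 :+ d :+ con 0))) refl d
    where open +-*-Solver

  total : (sumIndex (suc d) λ a₁ → sumIndex (suc d) λ (a₂ : Index n (suc d)) →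
      sumIndex (suc d) λ b₁ → indicator (Q b₁ ≟ Q a₁)) ≡ n ^ (3 * suc d ∸ 1)
  total = begin
    -- For fixed `a₁`, the vector `a₂` is free and `b₁` runs over the indices carrying the symbol
    -- `Q a₁`.
    _ ≡⟨ sumIndex-cong (suc d) (λ a₁ → trans
           (sumIndex-cong {n} (suc d) λ _ → fiber-size d Q latin (Q a₁))
           (sumIndex-const n (suc d) (n ^ d))) ⟩
    sumIndex {n} (suc d) (λ _ → n ^ suc d * n ^ d) ≡⟨ sumIndex-const n (suc d) _ ⟩
    n ^ suc d * (n ^ suc d * n ^ d)   ≡⟨ cong (n ^ suc d *_) (^-distribˡ-+-* n (suc d) d) ⟨
    n ^ suc d * n ^ (suc d + d)       ≡⟨ ^-distribˡ-+-* n (suc d) (suc d + d) ⟨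
    n ^ (suc d + (suc d + d))         ≡⟨ cong (n ^_) (exponent d) ⟩
    n ^ (3 * suc d ∸ 1)               ∎
    where open ≡-Reasoning

  pointwise : numCuboctahedra Q ≡ n ^ (3 * suc d ∸ 1) → ∀ a₁ a₂ b₁ →
    indicator (completes? Q latin a₁ a₂ b₁) ≡ indicator (Q b₁ ≟ Q a₁)
  -- Tightness is used once for each of the three nested sums, starting from the equality of totals.
  pointwise eq a₁ a₂ = sumIndex-tight (suc d) (bound a₁ a₂)
    (sumIndex-tight (suc d) (λ a₂ → sumIndex-mono (suc d) (bound a₁ a₂))
      (sumIndex-tight (suc d) (λ a₁ → sumIndex-mono (suc d) λ a₂ → sumIndex-mono (suc d) (bound a₁ a₂))
        (trans (sym (numCuboctahedra-completes Q latin)) (trans eq (sym total))) a₁) a₂)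

theorem3 : (d n : ℕ) → 1 ≤ d → 1 ≤ n → (Q : Hypercube n d) → IsLatinHypercube Q →
    (numCuboctahedra Q ≡ n ^ (3 * d ∸ 1)
    ⇔ (∀ (i j : Fin d) → i < j →
    Σ (Square n) λ L → IsLatinSquare L × IsotopicToGroupTable L
    × (∀ (α : Index n d) → PrincipallyIsotopic (plane Q i j α) L)))
theorem3 (suc d) (suc n) _ _ Q latin = mk⇔
  -- Positivity of the order supplies `zero` as the base point.
  (λ eq → planeQuadrangle⇒groupPlanes zero Q latin λ i j i<j →
    completesAll⇒planeQuadrangle Q latin (to eq) (<⇒≢ i<j))
  (λ planes → from (planeQuadrangle⇒completesAll Q latin (groupPlanes⇒planeQuadrangle Q planes)))
  where open Equivalence (numCuboctahedra-max⇔completesAll d Q latin)
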